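{- For each integer $m \ge 2$, there exists a cyclically $4$-edge-connected cubic graph $G$ with $|V(G)| = 8m$ and circumference $c(G) = 7m+2$.
   Context: The circumference $c(G)$ of a graph $G$ is the length of a longest cycle in $G$. A graph is cyclically $k$-edge-connected if at least $k$ edges must be removed to disconnect it into components among which at least two contain a cycle. -}

module Defs where

open import Data.Nat using (ℕ; zero; suc; _+_; _≤_; _<ᵇ_)
open import Data.Bool using (Bool; true; false; if_then_else_; _∧_; not)
open import Data.Fin using (Fin; zero; suc; toℕ; inject₁; fromℕ)
open import Data.List using (map; allFin)
open import Data.Nat.ListAction using (sum)
open import Data.Empty using (⊥)
open import Data.Product using (Σ; ∃; _×_)
open import Relation.Binary.PropositionalEquality using (_≡_)
open import Relation.Binary.Construct.Closure.ReflexiveTransitive using (Star)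
open import Relation.Nullary using (¬_)
open import Function.Definitions using (Injective)

record Graph (n : ℕ) : Set where
  field
    adj    : Fin n → Fin n → Bool
    sym    : ∀ i j → adj i j ≡ adj j i
    irrefl : ∀ i → adj i i ≡ false

open Graph public

Adj : {n : ℕ} → (Fin n → Fin n → Bool) → Fin n → Fin n → Set
Adj a i j = a i j ≡ true

degree : {n : ℕ} → Graph n → Fin n → ℕ
degree {n} G i = sum (map (λ j → if adj G i j then 1 else 0) (allFin n))

Cubic : {n : ℕ} → Graph n → Set
Cubic {n} G = ∀ (i : Fin n) → degree G i ≡ 3

-- A cycle of length (suc k), k ≥ 2, in the graph with adjacency a:
-- distinct vertices f 0, …, f k with f i ~ f (i+1) and f k ~ f 0.
record Cycle {n : ℕ} (a : Fin n → Fin n → Bool) (k : ℕ) : Set where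
  field
    long  : 2 ≤ k
    verts : Fin (suc k) → Fin n
    inj   : Injective _≡_ _≡_ verts
    step  : ∀ (i : Fin k) → Adj a (verts (inject₁ i)) (verts (suc i))
    close : Adj a (verts (fromℕ k)) (verts zero)

HasCycleOfLength : {n : ℕ} → Graph n → ℕ → Set
HasCycleOfLength G zero    = ⊥
HasCycleOfLength G (suc k) = Cycle (adj G) k

Circumference : {n : ℕ} → Graph n → ℕ → Set
Circumference G c = HasCycleOfLength G c × (∀ ℓ → HasCycleOfLength G ℓ → ℓ ≤ c)

OnCycle : {n : ℕ} → (Fin n → Fin n → Bool) → Fin n → Set
OnCycle {n} a v = Σ ℕ (λ k → Σ (Cycle a k) (λ C → ∃ (λ (i : Fin (suc k)) → Cycle.verts C i ≡ v)))

record EdgeSet {n : ℕ} (G : Graph n) : Set where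
  field
    mem    : Fin n → Fin n → Bool
    memSym : ∀ i j → mem i j ≡ mem j i
    sub    : ∀ i j → mem i j ≡ true → adj G i j ≡ true

size : {n : ℕ} {G : Graph n} → EdgeSet G → ℕ
size {n} F = sum (map (λ i → sum (map (λ j →
  if EdgeSet.mem F i j ∧ (toℕ i <ᵇ toℕ j) then 1 else 0) (allFin n))) (allFin n))

remove : {n : ℕ} (G : Graph n) → EdgeSet G → Fin n → Fin n → Bool
remove G F i j = adj G i j ∧ not (EdgeSet.mem F i j)

CyclicallyEdgeConnected : ℕ → {n : ℕ} → Graph n → Set
CyclicallyEdgeConnected k G =
  ∀ (F : EdgeSet G) (u v : Fin _) →
    OnCycle (remove G F) u → OnCycle (remove G F) v →
    ¬ Star (Adj (remove G F)) u v → k ≤ size F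

{-# OPTIONS --safe #-}
module Submission where

-- The graph is a ring of m copies of the Petersen graph minus two adjacent vertices.  Such a block
-- has four pendant half-edges, two to the left (at the former neighbours of one removed vertex) and
-- two to the right (at those of the other), and it is joined by two links to each of its neighbours.
--
-- Length at most 7m+2: as the Petersen graph is not Hamiltonian, no path or pair of paths crossing a
-- block from left to right covers its 8 vertices.  Hence in a block covered by the cycle C no part of
-- C joins the left to the right, so the block can be split into a part attached to the left only and
-- a part attached to the right only.  Three covered blocks would cut the ring into three pieces with
-- no edge of C between them, each of which misses one of the three blocks; so at most two blocks are
-- covered.  Length 7m+2 is reached by turning around in two neighbouring blocks, and passing
-- twice through each of the other blocks, covering 7 of its vertices.
--
-- Every edge cut with at least two vertices on both sides has at least 4 edges: a bichromatic block
-- contains two cut edges, and so do the links between two monochromatic blocks of different colours.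
-- The only remaining case is that all blocks but one have the same colour, which is a finite check.

open import Defs hiding (sym)
open import Data.Bool using (Bool; true; false; T; if_then_else_; _∧_; _∨_; not; _xor_)
import Data.Bool.Properties as Boolₚ
open import Data.Empty using (⊥; ⊥-elim)
open import Data.Fin as Fin using (Fin; zero; suc; toℕ; inject₁; fromℕ; combine; remQuot; _↑ˡ_; _↑ʳ_)
open import Data.Fin.Induction using (<-weakInduction)
open import Data.Fin.Patterns using (0F; 1F; 2F; 3F; 4F; 5F; 6F; 7F)
open import Data.Fin.Permutation using (permutation)
open import Data.Fin.Properties as Finₚ using (_≟_; any?; all?)
open import Data.Fin.Relation.Unary.Top using (View; view; ‵fromℕ; ‵inj₁; view-fromℕ; view-inject₁)
open import Data.List using (map; allFin; tabulate)
open import Data.List.Properties using (map-tabulate)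
open import Data.Nat using (ℕ; zero; suc; _+_; _*_; _∸_; _≤_; _<_; z≤n; s≤s; _≤ᵇ_; _<ᵇ_; _≤?_)
import Data.Nat.ListAction as List
open import Data.Nat.Properties hiding (_≟_; suc-injective; _≤?_)
open import Algebra.Properties.Semiring.Sum +-*-semiring using (sum-cong-≗; sum-remove; sum-permute; sum-replicate-zero; ∑-comm; ∑-distrib-+; *-distribˡ-sum; *-distribʳ-sum) renaming (sum to ∑)
open import Data.Nat.Solver using (module +-*-Solver)
open import Data.Product using (Σ; ∃; ∃₂; _×_; _,_; proj₁; proj₂; uncurry)
open import Data.Product.Properties using (≡-dec)
open import Data.Sum as Sum using (_⊎_; inj₁; inj₂; [_,_]′)
open import Function using (_∘_; id; mk⇔; Equivalence)
open import Function.Definitions using (Injective)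
open import Relation.Binary using (tri<; tri≈; tri>)
open import Relation.Binary.Construct.Closure.ReflexiveTransitive using (Star; ε; _◅_; _◅◅_)
open import Relation.Binary.PropositionalEquality
open import Relation.Nullary using (¬_; Dec; yes; no; does; contradiction)
open import Relation.Nullary.Decidable using (dec-true; dec-false; from-yes; decidable-stable; does-⇔; ¬?; ¬¬-excluded-middle; _×-dec_; _⊎-dec_; _→-dec_)

private
  variable
    k l n : ℕ

-- Finite sums

𝟙 : Bool → ℕ
𝟙 b = if b then 1 else 0

sum-map-allFin : (f : Fin n → ℕ) → List.sum (map f (allFin n)) ≡ ∑ f
sum-map-allFin {n} f = trans (cong List.sum (map-tabulate id f)) (sum-tabulate f)
  where
  sum-tabulate : ∀ {n} (f : Fin n → ℕ) → List.sum (tabulate f) ≡ ∑ f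
  sum-tabulate {zero}  f = refl
  sum-tabulate {suc n} f = cong (f zero +_) (sum-tabulate (f ∘ suc))

∑-mono-≤ : {f g : Fin n → ℕ} → (∀ i → f i ≤ g i) → ∑ f ≤ ∑ g
∑-mono-≤ {zero}  f≤g = z≤n
∑-mono-≤ {suc n} f≤g = +-mono-≤ (f≤g zero) (∑-mono-≤ (f≤g ∘ suc))

∑-const : ∀ n c → ∑ {n} (λ _ → c) ≡ n * c
∑-const zero    c = refl
∑-const (suc n) c = cong (c +_) (∑-const n c)

∑-↑ : ∀ k {l} (f : Fin (k + l) → ℕ) → ∑ f ≡ ∑ (f ∘ (_↑ˡ l)) + ∑ (f ∘ (k ↑ʳ_))
∑-↑ zero    f = refl
∑-↑ (suc k) f = trans (cong (f zero +_) (∑-↑ k (f ∘ suc))) (sym (+-assoc (f zero) _ _))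

∑-combine : ∀ k {l} (f : Fin (k * l) → ℕ) → ∑ f ≡ ∑ {k} λ i → ∑ {l} λ j → f (combine i j)
∑-combine zero        f = refl
∑-combine (suc k) {l} f = trans (∑-↑ l f) (cong (∑ (f ∘ (_↑ˡ (k * l))) +_) (∑-combine k (f ∘ (l ↑ʳ_))))

∑-δ : (c : Fin n) (g : Fin n → ℕ) → ∑ (λ j → 𝟙 (does (c ≟ j)) * g j) ≡ g c
∑-δ {suc n} zero    g = trans (cong₂ _+_ (+-identityʳ (g zero)) (sum-replicate-zero n)) (+-identityʳ _)
∑-δ {suc n} (suc c) g = ∑-δ c (g ∘ suc)

image : (Fin k → Fin n) → Fin n → Bool
image f v = does (any? λ i → f i ≟ v)

module _ {f : Fin k → Fin n} (f-inj : Injective _≡_ _≡_ f) where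

  image-fibre : ∀ v → ∑ (λ i → 𝟙 (does (f i ≟ v))) ≡ 𝟙 (image f v)
  image-fibre v with any? (λ i → f i ≟ v)
  ... | no ∄ = trans (sum-cong-≗ λ i → cong 𝟙 (dec-false (f i ≟ v) (∄ ∘ (i ,_)))) (sum-replicate-zero k)
  ... | yes (i₀ , refl) = trans (sum-cong-≗ same) (∑-δ i₀ (λ _ → 1))
    where
    same : ∀ i → 𝟙 (does (f i ≟ f i₀)) ≡ 𝟙 (does (i₀ ≟ i)) * 1
    same i with i₀ ≟ i
    ... | yes refl = cong 𝟙 (dec-true (f i ≟ f i) refl)
    ... | no i₀≢i  = cong 𝟙 (dec-false (f i ≟ f i₀) (i₀≢i ∘ sym ∘ f-inj))

  -- Each `g (f i)` is expanded as a sum against a Kronecker delta and the two sums are exchanged;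
  -- injectivity makes every fibre a singleton or empty.
  ∑-∘-injective : (g : Fin n → ℕ) → ∑ (g ∘ f) ≡ ∑ λ v → 𝟙 (image f v) * g v
  ∑-∘-injective g = begin
    ∑ (g ∘ f)                                        ≡⟨ sum-cong-≗ (λ i → ∑-δ (f i) g) ⟨
    ∑ (λ i → ∑ λ v → 𝟙 (does (f i ≟ v)) * g v)       ≡⟨ ∑-comm (λ i v → 𝟙 (does (f i ≟ v)) * g v) ⟩
    ∑ (λ v → ∑ λ i → 𝟙 (does (f i ≟ v)) * g v)       ≡⟨ sum-cong-≗ (λ v → *-distribʳ-sum (g v) (λ i → 𝟙 (does (f i ≟ v)))) ⟨
    ∑ (λ v → ∑ (λ i → 𝟙 (does (f i ≟ v))) * g v)     ≡⟨ sum-cong-≗ (λ v → cong (_* g v) (image-fibre v)) ⟩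
    ∑ (λ v → 𝟙 (image f v) * g v)                    ∎
    where open ≡-Reasoning

  ∑-image : ∑ (𝟙 ∘ image f) ≡ k
  ∑-image = begin
    ∑ (𝟙 ∘ image f)                 ≡⟨ sum-cong-≗ (λ v → *-identityʳ (𝟙 (image f v))) ⟨
    ∑ (λ v → 𝟙 (image f v) * 1)     ≡⟨ ∑-∘-injective (λ _ → 1) ⟨
    ∑ {k} (λ _ → 1)                 ≡⟨ ∑-const k 1 ⟩
    k * 1                           ≡⟨ *-identityʳ k ⟩
    k                               ∎
    where open ≡-Reasoning

  ∑-∘-injective-≤ : (g : Fin n → ℕ) → ∑ (g ∘ f) ≤ ∑ g
  ∑-∘-injective-≤ g = ≤-trans (≤-reflexive (∑-∘-injective g)) (∑-mono-≤ λ v → at-most v (image f v))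
    where
    at-most : ∀ v b → 𝟙 b * g v ≤ g v
    at-most v true  = ≤-reflexive (+-identityʳ (g v))
    at-most v false = z≤n

two-terms-≤-∑ : {i j : Fin n} → i ≢ j → (g : Fin n → ℕ) → g i + g j ≤ ∑ g
two-terms-≤-∑ {n} {i} {j} i≢j g =
  ≤-trans (≤-reflexive (cong (g i +_) (sym (+-identityʳ (g j))))) (∑-∘-injective-≤ pair-inj g)
  where
  pair : Fin 2 → Fin n
  pair 0F = i
  pair 1F = j
  pair-inj : Injective _≡_ _≡_ pair
  pair-inj {0F} {0F} _  = refl
  pair-inj {0F} {1F} eq = contradiction eq i≢j
  pair-inj {1F} {0F} eq = contradiction (sym eq) i≢j
  pair-inj {1F} {1F} _  = refl

-- The remaining count is restricted to positions after `p`, so that iteration yields increasing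
-- positions.
first-true : (g : Fin n → Bool) → 1 + k ≤ ∑ (𝟙 ∘ g) →
  ∃ λ p → g p ≡ true × k ≤ ∑ (λ q → 𝟙 (g q ∧ does (p Finₚ.<? q)))
first-true {suc n} g le with g zero in eq
first-true {suc n} g (s≤s le) | true  = zero , eq , ≤-trans le (≤-reflexive (sum-cong-≗ {n} pos))
  where
  pos : ∀ i → 𝟙 (g (suc i)) ≡ 𝟙 (g (suc i) ∧ true)
  pos i with g (suc i)
  ... | true  = refl
  ... | false = refl
first-true {suc n} g le | false with p , gp , le′ ← first-true (g ∘ suc) le = suc p , gp , ≤-trans le′ (m≤n+m _ _)

∧-trueˡ : ∀ {a b} → a ∧ b ≡ true → a ≡ true
∧-trueˡ {true} _ = refl

∧-trueʳ : ∀ {a b} → a ∧ b ≡ true → b ≡ true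
∧-trueʳ {true} eq = eq

does-true : ∀ {p} {P : Set p} (P? : Dec P) → does P? ≡ true → P
does-true (yes p) _ = p

three-true : (g : Fin n → Bool) → 3 ≤ ∑ (𝟙 ∘ g) →
  ∃ λ p → ∃₂ λ q r → p Fin.< q × q Fin.< r × g p ≡ true × g q ≡ true × g r ≡ true
three-true g le
  with p , gp , le₁ ← first-true g le
  with q , gq , le₂ ← first-true _ le₁
  with r , gr , _   ← first-true _ le₂ =
  p , q , r , does-true (p Finₚ.<? q) (∧-trueʳ gq) , does-true (q Finₚ.<? r) (∧-trueʳ gr) ,
  gp , ∧-trueˡ gq , ∧-trueˡ (∧-trueˡ gr)

-- The cyclic order on Fin (suc n)

next : Fin (suc n) → Fin (suc n)
next i with view i
... | ‵fromℕ         = zero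
... | ‵inj₁ {i = j} _ = suc j

prev : Fin (suc n) → Fin (suc n)
prev {n} zero = fromℕ n
prev (suc i)  = inject₁ i

next-fromℕ : ∀ n → next (fromℕ n) ≡ zero
next-fromℕ n rewrite view-fromℕ n = refl

next-inject₁ : (i : Fin n) → next (inject₁ i) ≡ suc i
next-inject₁ i rewrite view-inject₁ i = refl

next-prev : (i : Fin (suc n)) → next (prev i) ≡ i
next-prev {n} zero = next-fromℕ n
next-prev (suc i)  = next-inject₁ i

prev-next : (i : Fin (suc n)) → prev (next i) ≡ i
prev-next i with view i
... | ‵fromℕ  = refl
... | ‵inj₁ _ = refl

next≢id : (i : Fin (2 + n)) → next i ≢ i
next≢id i eq with view i
next≢id _ () | ‵fromℕ
... | ‵inj₁ {i = j} _ = contradiction (cong toℕ eq) (λ e → 1+n≢n (trans e (Finₚ.toℕ-inject₁ j)))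

next≢prev : (i : Fin (3 + n)) → next i ≢ prev i
next≢prev i eq with view i
next≢prev _ () | ‵fromℕ
next≢prev _ () | ‵inj₁ {i = zero} _
next≢prev _ eq | ‵inj₁ {i = suc j} _ =
  contradiction (cong toℕ eq) λ e →
    m≢1+n+m _ (sym (trans e (trans (Finₚ.toℕ-inject₁ (inject₁ j)) (Finₚ.toℕ-inject₁ j))))

-- Induction once around the ring, from just after `p` back to `p`. In the linear order it climbs
-- from `p` to the top, wraps to `zero`, and climbs again.
next-induction : (P : Fin (suc n) → Set) (p : Fin (suc n)) → P (next p) →
  (∀ b → b ≢ p → P b → P (next b)) → ∀ b → P b
next-induction {n} P p Pp⁺ step b = <-weakInduction P P₀ up b
  where
  Above : Fin (suc n) → Set
  Above c = p Fin.< c → P c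
  above : ∀ c → Above c
  above = <-weakInduction Above (λ ()) λ i IH p<i → subst P (next-inject₁ i) (climb i IH p<i)
    where
    climb : ∀ i → Above (inject₁ i) → p Fin.< suc i → P (next (inject₁ i))
    climb i IH p<i with inject₁ i ≟ p
    ... | yes refl = Pp⁺
    ... | no i≢p   = step (inject₁ i) i≢p (IH (≤∧≢⇒< (≤-trans (≤-pred p<i) (≤-reflexive (sym (Finₚ.toℕ-inject₁ i)))) (i≢p ∘ sym ∘ Finₚ.toℕ-injective)))
  P₀ : P zero
  P₀ with fromℕ n ≟ p
  ... | yes refl = subst P (next-fromℕ n) Pp⁺
  ... | no top≢p = subst P (next-fromℕ n) (step (fromℕ n) top≢p (above (fromℕ n) (≤∧≢⇒< (Finₚ.≤fromℕ p) (top≢p ∘ sym ∘ Finₚ.toℕ-injective))))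
  up : ∀ i → P (inject₁ i) → P (suc i)
  up i Pi with inject₁ i ≟ p
  ... | yes refl = subst P (next-inject₁ i) Pp⁺
  ... | no i≢p   = subst P (next-inject₁ i) (step (inject₁ i) i≢p Pi)

next-invariant : {A : Set} (f : Fin (suc n) → A) → (∀ i → f (next i) ≡ f i) → ∀ i j → f i ≡ f j
next-invariant f inv i j = trans (to-zero i) (sym (to-zero j))
  where
  to-zero : ∀ i → f i ≡ f zero
  to-zero = <-weakInduction (λ i → f i ≡ f zero) refl
    λ i eq → trans (trans (cong f (sym (next-inject₁ i))) (inv (inject₁ i))) eq

-- The ring of blocks

-- Only the offset to the neighbouring block is recorded, so facts about one block do not depend on
-- the length of the ring and can be settled by enumeration.
data Shift : Set where
  stay fwd bwd : Shift

opp : Shift → Shift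
opp stay = stay
opp fwd  = bwd
opp bwd  = fwd

shift : Shift → Fin (suc n) → Fin (suc n)
shift stay b = b
shift fwd  b = next b
shift bwd  b = prev b

-- A block is the 8-cycle 0 1 … 7 with the chords 1–5 and 3–7: the Petersen graph minus two adjacent
-- vertices, whose other neighbours were 0, 4 and 2, 6.  The second argument is the colour of a
-- proper 3-edge-colouring: 0 and 1 alternate on the 8-cycle, 2 is for the chords and for the links,
-- which join 2 and 6 to 0 and 4 of the next block.  With the colour as index of a neighbour, taking
-- the neighbour of a given index is an involution.
tgt : Fin 8 → Fin 3 → Fin 8
tgt 0F 0F = 1F
tgt 1F 0F = 0F
tgt 2F 0F = 3F
tgt 3F 0F = 2F
tgt 4F 0F = 5F
tgt 5F 0F = 4F
tgt 6F 0F = 7F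
tgt 7F 0F = 6F
tgt 0F 1F = 7F
tgt 1F 1F = 2F
tgt 2F 1F = 1F
tgt 3F 1F = 4F
tgt 4F 1F = 3F
tgt 5F 1F = 6F
tgt 6F 1F = 5F
tgt 7F 1F = 0F
tgt 0F 2F = 2F
tgt 1F 2F = 5F
tgt 2F 2F = 0F
tgt 3F 2F = 7F
tgt 4F 2F = 6F
tgt 5F 2F = 1F
tgt 6F 2F = 4F
tgt 7F 2F = 3F

sh : Fin 8 → Fin 3 → Shift
sh 0F 2F = bwd
sh 2F 2F = fwd
sh 4F 2F = bwd
sh 6F 2F = fwd
sh _  _  = stay

tgt-involutive : ∀ x s → tgt (tgt x s) s ≡ x
tgt-involutive = from-yes (all? λ x → all? λ s → tgt (tgt x s) s ≟ x)

-- The three neighbours of a vertex differ in position even when their blocks are ignored, so no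
-- multiple edges arise even if the ring has only two blocks.
tgt-injective : ∀ x s t → tgt x s ≡ tgt x t → s ≡ t
tgt-injective = from-yes (all? λ x → all? λ s → all? λ t → (tgt x s ≟ tgt x t) →-dec (s ≟ t))

tgt-irrefl : ∀ x s → tgt x s ≢ x
tgt-irrefl = from-yes (all? λ x → all? λ s → ¬? (tgt x s ≟ x))

sh-tgt : ∀ x s → sh (tgt x s) s ≡ opp (sh x s)
sh-tgt 0F 0F = refl
sh-tgt 1F 0F = refl
sh-tgt 2F 0F = refl
sh-tgt 3F 0F = refl
sh-tgt 4F 0F = refl
sh-tgt 5F 0F = refl
sh-tgt 6F 0F = refl
sh-tgt 7F 0F = refl
sh-tgt 0F 1F = refl
sh-tgt 1F 1F = refl
sh-tgt 2F 1F = refl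
sh-tgt 3F 1F = refl
sh-tgt 4F 1F = refl
sh-tgt 5F 1F = refl
sh-tgt 6F 1F = refl
sh-tgt 7F 1F = refl
sh-tgt 0F 2F = refl
sh-tgt 1F 2F = refl
sh-tgt 2F 2F = refl
sh-tgt 3F 2F = refl
sh-tgt 4F 2F = refl
sh-tgt 5F 2F = refl
sh-tgt 6F 2F = refl
sh-tgt 7F 2F = refl

shift-opp : ∀ d (b : Fin (suc n)) → shift (opp d) (shift d b) ≡ b
shift-opp stay b = refl
shift-opp fwd  b = prev-next b
shift-opp bwd  b = next-prev b

W : ℕ → Set
W n = Fin 8 × Fin (suc n)

nb : W n → Fin 3 → W n
nb (x , b) s = tgt x s , shift (sh x s) b

nb-involutive : (v : W n) (s : Fin 3) → nb (nb v s) s ≡ v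
nb-involutive (x , b) s =
  cong₂ _,_ (tgt-involutive x s) (trans (cong (λ d → shift d (shift (sh x s) b)) (sh-tgt x s)) (shift-opp (sh x s) b))

enc : W n → Fin (8 * suc n)
enc = uncurry combine

dec : Fin (8 * suc n) → W n
dec {n} = remQuot {8} (suc n)

dec-enc : (v : W n) → dec (enc v) ≡ v
dec-enc (x , b) = Finₚ.remQuot-combine x b

enc-dec : (i : Fin (8 * suc n)) → enc (dec {n} i) ≡ i
enc-dec {n} = Finₚ.combine-remQuot {8} (suc n)

enc-injective : {v w : W n} → enc v ≡ enc w → v ≡ w
enc-injective {v = v} {w} eq = trans (sym (dec-enc v)) (trans (cong dec eq) (dec-enc w))

dec-injective : {i j : Fin (8 * suc n)} → dec {n} i ≡ dec {n} j → i ≡ j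
dec-injective {n} {i} {j} eq = trans (sym (enc-dec {n} i)) (trans (cong enc eq) (enc-dec {n} j))

nbr : Fin (8 * suc n) → Fin 3 → Fin (8 * suc n)
nbr {n} i s = enc (nb (dec {n} i) s)

dec-nbr : (i : Fin (8 * suc n)) (s : Fin 3) → dec (nbr {n} i s) ≡ nb (dec {n} i) s
dec-nbr {n} i s = dec-enc (nb (dec {n} i) s)

nbr-enc : (v : W n) (s : Fin 3) → nbr {n} (enc v) s ≡ enc (nb v s)
nbr-enc v s = cong (λ w → enc (nb w s)) (dec-enc v)

nbr-involutive : (i : Fin (8 * suc n)) (s : Fin 3) → nbr {n} (nbr {n} i s) s ≡ i
nbr-involutive {n} i s = trans (nbr-enc (nb (dec {n} i) s) s) (trans (cong enc (nb-involutive (dec {n} i) s)) (enc-dec {n} i))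

nbr-injective : (i : Fin (8 * suc n)) → Injective _≡_ _≡_ (nbr {n} i)
nbr-injective {n} i {s} {t} eq = tgt-injective (proj₁ (dec {n} i)) s t (cong proj₁ (enc-injective eq))

nbr-irrefl : (i : Fin (8 * suc n)) (s : Fin 3) → nbr {n} i s ≢ i
nbr-irrefl {n} i s eq =
  tgt-irrefl (proj₁ (dec {n} i)) s (cong proj₁ (trans (sym (dec-nbr {n} i s)) (cong (dec {n}) eq)))

-- Symmetry holds because following a fixed colour is an involution; degree three will follow from
-- the injectivity of `nbr i`.
blockRing : ∀ n → Graph (8 * suc n)
blockRing n = record
  { adj    = λ i j → image (nbr {n} i) j
  ; sym    = λ i j → does-⇔ (mk⇔ (flip-edge i j) (flip-edge j i)) (any? λ s → nbr {n} i s ≟ j) (any? λ s → nbr {n} j s ≟ i)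
  ; irrefl = λ i → dec-false (any? λ s → nbr {n} i s ≟ i) λ (s , eq) → nbr-irrefl {n} i s eq
  }
  where
  flip-edge : ∀ i j → ∃ (λ s → nbr {n} i s ≡ j) → ∃ λ s → nbr {n} j s ≡ i
  flip-edge i _ (s , refl) = s , nbr-involutive {n} i s

adj-nbr : (i : Fin (8 * suc n)) (s : Fin 3) → adj (blockRing n) i (nbr {n} i s) ≡ true
adj-nbr {n} i s = dec-true (any? λ t → nbr {n} i t ≟ nbr {n} i s) (s , refl)

nbr-adj : (i j : Fin (8 * suc n)) → adj (blockRing n) i j ≡ true → ∃ λ s → nbr {n} i s ≡ j
nbr-adj {n} i j = does-true (any? λ t → nbr {n} i t ≟ j)

blockRing-cubic : ∀ n → Cubic (blockRing n)
blockRing-cubic n i = trans (sum-map-allFin (𝟙 ∘ adj (blockRing n) i)) (∑-image (nbr-injective {n} i))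

-- Tautologies

BoolFun : ℕ → Set
BoolFun zero    = Bool
BoolFun (suc n) = Bool → BoolFun n

Tautology : ∀ n → BoolFun n → Set
Tautology zero    b = b ≡ true
Tautology (suc n) f = ∀ b → Tautology n (f b)

holdsEverywhere : ∀ n → BoolFun n → Bool
holdsEverywhere zero    b = b
holdsEverywhere (suc n) f = holdsEverywhere n (f true) ∧ holdsEverywhere n (f false)

-- Proof by reflection: evaluating the truth table once, with `refl`, gives the statement for all
-- Boolean arguments.
tautology : ∀ n (f : BoolFun n) → holdsEverywhere n f ≡ true → Tautology n f
tautology zero    f eq       = eq
tautology (suc n) f eq true  = tautology n (f true) (∧-trueˡ eq)
tautology (suc n) f eq false = tautology n (f false) (∧-trueʳ {holdsEverywhere n (f true)} eq)

-- Edge cuts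

diff : Bool → Bool → ℕ
diff a b = 𝟙 (a xor b)

diff-comm : ∀ a b → diff a b ≡ diff b a
diff-comm a b = cong 𝟙 (Boolₚ.xor-comm a b)

inner : (Fin 8 → Bool) → ℕ
inner X = diff (X 0F) (X 1F) + diff (X 1F) (X 2F) + diff (X 2F) (X 3F) + diff (X 3F) (X 4F) +
          diff (X 4F) (X 5F) + diff (X 5F) (X 6F) + diff (X 6F) (X 7F) + diff (X 7F) (X 0F) +
          diff (X 1F) (X 5F) + diff (X 3F) (X 7F)

-- The number of cut edges leaving a block with colouring X when all other blocks have colour c.
leaving : Bool → (Fin 8 → Bool) → ℕ
leaving c X = diff (X 2F) c + diff (X 6F) c + (diff c (X 0F) + diff c (X 4F))

-- Turns statements about all colourings of a block into Boolean functions that can be tabulated.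
row : Bool → Bool → Bool → Bool → Bool → Bool → Bool → Bool → Fin 8 → Bool
row x₀ _ _ _ _ _ _ _ 0F = x₀
row _ x₁ _ _ _ _ _ _ 1F = x₁
row _ _ x₂ _ _ _ _ _ 2F = x₂
row _ _ _ x₃ _ _ _ _ 3F = x₃
row _ _ _ _ x₄ _ _ _ 4F = x₄
row _ _ _ _ _ x₅ _ _ 5F = x₅
row _ _ _ _ _ _ x₆ _ 6F = x₆
row _ _ _ _ _ _ _ x₇ 7F = x₇

∨-true : ∀ {a b} → a ∨ b ≡ true → a ≡ true ⊎ b ≡ true
∨-true {true}  _  = inj₁ refl
∨-true {false} eq = inj₂ eq

≤ᵇ-true : ∀ {a b} → (a ≤ᵇ b) ≡ true → a ≤ b
≤ᵇ-true {a} {b} eq = ≤ᵇ⇒≤ a b (subst T (sym eq) _)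

-- The block contains a spanning 8-cycle, and a cycle is never cut in exactly one edge.
cut-or-constant : (X : Fin 8 → Bool) → 2 ≤ inner X ⊎ (∀ i → X i ≡ X 0F)
cut-or-constant X with ∨-true (tautology 8 check refl (X 0F) (X 1F) (X 2F) (X 3F) (X 4F) (X 5F) (X 6F) (X 7F))
  where
  check : BoolFun 8
  check x₀ x₁ x₂ x₃ x₄ x₅ x₆ x₇ = let X = row x₀ x₁ x₂ x₃ x₄ x₅ x₆ x₇ in
    (2 ≤ᵇ inner X) ∨ does (all? λ i → X i Boolₚ.≟ X 0F)
... | inj₁ 2≤ = inj₁ (≤ᵇ-true 2≤)
... | inj₂ eq = inj₂ λ
  { 0F → c 0F ; 1F → c 1F ; 2F → c 2F ; 3F → c 3F ; 4F → c 4F ; 5F → c 5F ; 6F → c 6F ; 7F → c 7F }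
  where
  c = does-true (all? λ i → row (X 0F) (X 1F) (X 2F) (X 3F) (X 4F) (X 5F) (X 6F) (X 7F) i Boolₚ.≟ X 0F) eq

-- A truth table in nine variables. Two vertices of the minority colour are required, since a single
-- one is cut off by three edges.
two-vertex-cut : ∀ (X : Fin 8 → Bool) c {i j} → i ≢ j → X i ≡ not c → X j ≡ not c →
  4 ≤ inner X + leaving c X
two-vertex-cut X c {i} {j} i≢j Xi Xj
  with ∨-true (tautology 9 check refl c (X 0F) (X 1F) (X 2F) (X 3F) (X 4F) (X 5F) (X 6F) (X 7F))
  where
  check : BoolFun 9
  check c x₀ x₁ x₂ x₃ x₄ x₅ x₆ x₇ = let X = row x₀ x₁ x₂ x₃ x₄ x₅ x₆ x₇ in
    (∑ (λ i → diff (X i) c) ≤ᵇ 1) ∨ (4 ≤ᵇ inner X + leaving c X)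
... | inj₂ 4≤ = ≤ᵇ-true 4≤
... | inj₁ ≤1 = contradiction (≤-trans 2≤∑ (≤ᵇ-true ≤1)) λ { (s≤s ()) }
  where
  one : ∀ c {x} → x ≡ not c → diff x c ≡ 1
  one true  refl = refl
  one false refl = refl
  2≤∑ : 2 ≤ ∑ (λ i → diff (X i) c)
  2≤∑ = ≤-trans (≤-reflexive (sym (cong₂ _+_ (one c Xi) (one c Xj)))) (two-terms-≤-∑ i≢j λ i → diff (X i) c)

module Cut (Z : W (suc n) → Bool) where

  block : Fin (2 + n) → Fin 8 → Bool
  block b x = Z (x , b)

  link : Fin (2 + n) → ℕ
  link b = diff (Z (2F , b)) (Z (0F , next b)) + diff (Z (6F , b)) (Z (4F , next b))

  -- Each link is charged to the block on its left, so `∑ E` counts every cut edge once.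
  E : Fin (2 + n) → ℕ
  E b = inner (block b) + link b

  all-but-one : ∀ p c → (∀ b → b ≢ p → ∀ x → Z (x , b) ≡ c) →
    ∀ {v w} → v ≢ w → Z v ≡ not c → Z w ≡ not c → 4 ≤ ∑ E
  all-but-one p c rest {x , b} {y , b′} v≢w Zv Zw with b ≟ p | b′ ≟ p
  ... | no b≢p | _ = contradiction (trans (sym (rest b b≢p x)) Zv) (Boolₚ.not-¬ refl)
  ... | yes _ | no b≢p = contradiction (trans (sym (rest b′ b≢p y)) Zw) (Boolₚ.not-¬ refl)
  ... | yes refl | yes refl = begin
    4                                           ≤⟨ two-vertex-cut (block p) c (v≢w ∘ cong (_, p)) Zv Zw ⟩
    inner (block p) + leaving c (block p)       ≡⟨ +-assoc (inner (block p)) _ _ ⟨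
    inner (block p) + (diff (Z (2F , p)) c + diff (Z (6F , p)) c) + (diff c (Z (0F , p)) + diff c (Z (4F , p)))
                                                ≡⟨ cong₂ (λ s t → inner (block p) + s + t) right left ⟨
    -- The links entering block `p` are charged to block `prev p`, which differs from `p` because
    -- there are at least two blocks.
    E p + link (prev p)                         ≤⟨ +-monoʳ-≤ (E p) (m≤n+m (link (prev p)) (inner (block (prev p)))) ⟩
    E p + E (prev p)                            ≤⟨ two-terms-≤-∑ (λ eq → prev≢p (sym eq)) E ⟩
    ∑ E                                         ∎
    where
    open ≤-Reasoning
    prev≢p : prev p ≢ p
    prev≢p eq = next≢id (prev p) (trans (next-prev p) (sym eq))
    right : link p ≡ diff (Z (2F , p)) c + diff (Z (6F , p)) c
    right = cong₂ (λ s t → diff (Z (2F , p)) s + diff (Z (6F , p)) t) (rest (next p) (next≢id p) 0F) (rest (next p) (next≢id p) 4F)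
    left : link (prev p) ≡ diff c (Z (0F , p)) + diff c (Z (4F , p))
    left = cong₂ _+_
      (cong₂ diff (rest (prev p) prev≢p 2F) (cong (λ b → Z (0F , b)) (next-prev p)))
      (cong₂ diff (rest (prev p) prev≢p 6F) (cong (λ b → Z (4F , b)) (next-prev p)))

  constant : ∀ b → ¬ 2 ≤ E b → ∀ x → Z (x , b) ≡ Z (0F , b)
  constant b E<2 with cut-or-constant (block b)
  ... | inj₁ 2≤ = contradiction (≤-trans 2≤ (m≤m+n (inner (block b)) (link b))) E<2
  ... | inj₂ eq = eq

  same-colour : ∀ b → ¬ 2 ≤ E b → (∀ x → Z (x , next b) ≡ Z (0F , next b)) → Z (0F , next b) ≡ Z (0F , b)
  same-colour b E<2 const⁺ with Z (0F , next b) Boolₚ.≟ Z (0F , b)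
  ... | yes eq = eq
  ... | no neq = contradiction (≤-trans (≤-reflexive (sym 2-link)) (m≤n+m (link b) (inner (block b)))) E<2
    where
    differ : ∀ s t → t ≢ s → diff s t ≡ 1
    differ true  true  ne = contradiction refl ne
    differ true  false ne = refl
    differ false true  ne = refl
    differ false false ne = contradiction refl ne
    2-link : link b ≡ 2
    2-link = cong₂ _+_
      (differ _ _ λ eq → neq (trans eq (constant b E<2 2F)))
      (differ _ _ λ eq → neq (trans (sym (const⁺ 4F)) (trans eq (constant b E<2 6F))))

  -- The colour spreads from block `next p` around the ring to the last block before `p`. The motive
  -- carries `b ≢ p` because block `p` itself may be bichromatic.
  all-but-one-good : ∀ p → (∀ b → b ≢ p → ¬ 2 ≤ E b) → ∀ b → b ≢ p → ∀ x → Z (x , b) ≡ Z (0F , next p)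
  all-but-one-good p good = next-induction
    (λ b → b ≢ p → ∀ x → Z (x , b) ≡ Z (0F , next p)) p
    (λ ne → constant (next p) (good (next p) ne))
    λ b b≢p IH ne x → let const⁺ = constant (next b) (good (next b) ne) in
      trans (const⁺ x) (trans (same-colour b (good b b≢p) const⁺) (IH b≢p 0F))

  -- Two blocks charged at least two edges each suffice. Otherwise all blocks but one share a
  -- colour, and the two given vertices of the opposite colour lie in the exceptional block.
  cut-≥4 : ∀ {u u′ v v′} → u ≢ u′ → Z u ≡ true → Z u′ ≡ true → v ≢ v′ → Z v ≡ false → Z v′ ≡ false → 4 ≤ ∑ E
  cut-≥4 u≢u′ Zu Zu′ v≢v′ Zv Zv′ = search
    where
    finish : ∀ p → (∀ b → b ≢ p → ¬ 2 ≤ E b) → 4 ≤ ∑ E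
    finish p good with Z (0F , next p) | all-but-one-good p good
    ... | true  | rest = all-but-one p true rest v≢v′ Zv Zv′
    ... | false | rest = all-but-one p false rest u≢u′ Zu Zu′
    search : 4 ≤ ∑ E
    search with any? (λ p → 2 ≤? E p)
    -- No block is exceptional here, so any block may play the part of `p`.
    ... | no ∄ = finish zero λ b _ 2≤ → ∄ (b , 2≤)
    ... | yes (p , 2≤p) with any? (λ q → (¬? (q ≟ p)) ×-dec (2 ≤? E q))
    ...   | yes (q , q≢p , 2≤q) = ≤-trans (+-mono-≤ 2≤q 2≤p) (two-terms-≤-∑ q≢p E)
    ...   | no ∄ = finish p λ b b≢p 2≤ → ∄ (b , b≢p , 2≤)

-- Double counting of cut edges

-- Every ordered pair in `F` is increasing in one of its two orientations, as `irrefl` excludes the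
-- diagonal.
size-twice : {G : Graph n} (F : EdgeSet G) → ∑ (λ i → ∑ λ j → 𝟙 (EdgeSet.mem F i j)) ≤ 2 * size F
size-twice {n} {G} F = begin
  ∑ (λ i → ∑ λ j → 𝟙 (mem i j))                    ≤⟨ ∑-mono-≤ (λ i → ∑-mono-≤ λ j → oriented i j) ⟩
  ∑ (λ i → ∑ λ j → up i j + up j i)                ≡⟨ sum-cong-≗ (λ i → ∑-distrib-+ (up i) (λ j → up j i)) ⟩
  ∑ (λ i → ∑ (up i) + ∑ λ j → up j i)              ≡⟨ ∑-distrib-+ (λ i → ∑ (up i)) (λ i → ∑ λ j → up j i) ⟩
  ∑ (λ i → ∑ (up i)) + ∑ (λ i → ∑ λ j → up j i)    ≡⟨ cong (∑ (λ i → ∑ (up i)) +_) (∑-comm up) ⟨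
  ∑ (λ i → ∑ (up i)) + ∑ (λ i → ∑ (up i))          ≡⟨ cong₂ _+_ size-∑ (trans (+-identityʳ (size F)) size-∑) ⟨
  2 * size F                                       ∎
  where
  open ≤-Reasoning
  open EdgeSet F
  up : Fin n → Fin n → ℕ
  up i j = 𝟙 (mem i j ∧ (toℕ i <ᵇ toℕ j))
  size-∑ : size F ≡ ∑ λ i → ∑ (up i)
  size-∑ = trans (sum-map-allFin λ i → List.sum (map (up i) (allFin n))) (sum-cong-≗ λ i → sum-map-allFin (up i))
  <ᵇ-true : ∀ {a b} → a < b → (a <ᵇ b) ≡ true
  <ᵇ-true lt = Equivalence.to Boolₚ.T-≡ (<⇒<ᵇ lt)
  oriented : ∀ i j → 𝟙 (mem i j) ≤ up i j + up j i
  oriented i j with mem i j in eq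
  ... | false = z≤n
  ... | true with Finₚ.<-cmp i j
  ...   | tri< i<j _ _ = ≤-trans (≤-reflexive (sym (cong 𝟙 (<ᵇ-true i<j)))) (m≤m+n _ _)
  ...   | tri> _ _ j<i = ≤-trans (≤-reflexive (sym (cong 𝟙 (cong₂ _∧_ (trans (memSym j i) eq) (<ᵇ-true j<i))))) (m≤n+m _ _)
  ...   | tri≈ _ refl _ = contradiction (trans (sym (sub i i eq)) (irrefl G i)) λ ()

module _ (Z : W (suc n) → Bool) where
  open Cut Z

  -- An edge inside the block is met from both of its ends, a link only from its end in block `b`.
  half-edges : ∀ b → (∑ λ x → ∑ λ s → diff (Z (x , b)) (Z (nb (x , b) s))) ≡ 2 * inner (block b) + link b + link (prev b)
  half-edges b = begin
    (∑ λ x → ∑ λ s → diff (Z (x , b)) (Z (nb (x , b) s)))  ≡⟨ sum-cong-≗ (λ x → sum-cong-≗ (canonical x)) ⟩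
    (∑ λ x → ∑ λ s → table x s)                            ≡⟨ arith
      (d 0F 1F) (d 1F 2F) (d 2F 3F) (d 3F 4F) (d 4F 5F) (d 5F 6F) (d 6F 7F) (d 7F 0F) (d 1F 5F) (d 3F 7F)
      (diff (Z (2F , b)) (Z (0F , next b))) (diff (Z (6F , b)) (Z (4F , next b))) (entering 2F 0F) (entering 6F 4F) ⟩
    2 * inner (block b) + link b + link (prev b)           ∎
    where
    open ≡-Reasoning
    d : Fin 8 → Fin 8 → ℕ
    d x y = diff (Z (x , b)) (Z (y , b))
    d-comm : ∀ x y → d x y ≡ d y x
    d-comm x y = diff-comm (Z (x , b)) (Z (y , b))
    -- Writing `next (prev b)` for `b` makes the two entering terms add up to `link (prev b)` by
    -- definition.
    entering : Fin 8 → Fin 8 → ℕ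
    entering x y = diff (Z (x , prev b)) (Z (y , next (prev b)))
    entering-comm : ∀ x y → diff (Z (y , b)) (Z (x , prev b)) ≡ entering x y
    entering-comm x y = trans (diff-comm (Z (y , b)) _) (cong (λ c → diff (Z (x , prev b)) (Z (y , c))) (sym (next-prev b)))
    -- The same summands with every edge in one fixed orientation: both ends of an inner edge give
    -- the same term, and linear arithmetic finishes.
    table : Fin 8 → Fin 3 → ℕ
    table 0F 0F = d 0F 1F
    table 1F 0F = d 0F 1F
    table 2F 0F = d 2F 3F
    table 3F 0F = d 2F 3F
    table 4F 0F = d 4F 5F
    table 5F 0F = d 4F 5F
    table 6F 0F = d 6F 7F
    table 7F 0F = d 6F 7F
    table 0F 1F = d 7F 0F
    table 1F 1F = d 1F 2F
    table 2F 1F = d 1F 2F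
    table 3F 1F = d 3F 4F
    table 4F 1F = d 3F 4F
    table 5F 1F = d 5F 6F
    table 6F 1F = d 5F 6F
    table 7F 1F = d 7F 0F
    table 0F 2F = entering 2F 0F
    table 1F 2F = d 1F 5F
    table 2F 2F = diff (Z (2F , b)) (Z (0F , next b))
    table 3F 2F = d 3F 7F
    table 4F 2F = entering 6F 4F
    table 5F 2F = d 1F 5F
    table 6F 2F = diff (Z (6F , b)) (Z (4F , next b))
    table 7F 2F = d 3F 7F
    canonical : ∀ x s → diff (Z (x , b)) (Z (nb (x , b) s)) ≡ table x s
    canonical 0F 0F = refl
    canonical 1F 0F = d-comm 1F 0F
    canonical 2F 0F = refl
    canonical 3F 0F = d-comm 3F 2F
    canonical 4F 0F = refl
    canonical 5F 0F = d-comm 5F 4F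
    canonical 6F 0F = refl
    canonical 7F 0F = d-comm 7F 6F
    canonical 0F 1F = d-comm 0F 7F
    canonical 1F 1F = refl
    canonical 2F 1F = d-comm 2F 1F
    canonical 3F 1F = refl
    canonical 4F 1F = d-comm 4F 3F
    canonical 5F 1F = refl
    canonical 6F 1F = d-comm 6F 5F
    canonical 7F 1F = refl
    canonical 0F 2F = entering-comm 2F 0F
    canonical 1F 2F = refl
    canonical 2F 2F = refl
    canonical 3F 2F = refl
    canonical 4F 2F = entering-comm 6F 4F
    canonical 5F 2F = d-comm 5F 1F
    canonical 6F 2F = refl
    canonical 7F 2F = d-comm 7F 3F
    arith : ∀ e₀ e₁ e₂ e₃ e₄ e₅ e₆ e₇ h₁ h₃ l₂ l₆ l₀ l₄ →
      (e₀ + (e₇ + (l₀ + 0))) + ((e₀ + (e₁ + (h₁ + 0))) + ((e₂ + (e₁ + (l₂ + 0))) + ((e₂ + (e₃ + (h₃ + 0))) +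
      ((e₄ + (e₃ + (l₄ + 0))) + ((e₄ + (e₅ + (h₁ + 0))) + ((e₆ + (e₅ + (l₆ + 0))) + ((e₆ + (e₇ + (h₃ + 0))) + 0)))))))
      ≡ 2 * (e₀ + e₁ + e₂ + e₃ + e₄ + e₅ + e₆ + e₇ + h₁ + h₃) + (l₂ + l₆) + (l₀ + l₄)
    arith = solve 14 (λ e₀ e₁ e₂ e₃ e₄ e₅ e₆ e₇ h₁ h₃ l₂ l₆ l₀ l₄ →
      ((e₀ :+ (e₇ :+ (l₀ :+ con 0))) :+ ((e₀ :+ (e₁ :+ (h₁ :+ con 0))) :+ ((e₂ :+ (e₁ :+ (l₂ :+ con 0))) :+ ((e₂ :+ (e₃ :+ (h₃ :+ con 0))) :+
      ((e₄ :+ (e₃ :+ (l₄ :+ con 0))) :+ ((e₄ :+ (e₅ :+ (h₁ :+ con 0))) :+ ((e₆ :+ (e₅ :+ (l₆ :+ con 0))) :+ ((e₆ :+ (e₇ :+ (h₃ :+ con 0))) :+ con 0))))))))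
      := con 2 :* (e₀ :+ e₁ :+ e₂ :+ e₃ :+ e₄ :+ e₅ :+ e₆ :+ e₇ :+ h₁ :+ h₃) :+ (l₂ :+ l₆) :+ (l₀ :+ l₄)) refl
      where open +-*-Solver

  ∑-half-edges : (∑ λ x → ∑ λ b → ∑ λ s → diff (Z (x , b)) (Z (nb (x , b) s))) ≡ 2 * ∑ E
  ∑-half-edges = begin
    (∑ λ x → ∑ λ b → ∑ λ s → diff (Z (x , b)) (Z (nb (x , b) s)))
      ≡⟨ ∑-comm (λ x b → ∑ λ s → diff (Z (x , b)) (Z (nb (x , b) s))) ⟩
    (∑ λ b → ∑ λ x → ∑ λ s → diff (Z (x , b)) (Z (nb (x , b) s)))
      ≡⟨ sum-cong-≗ half-edges ⟩
    ∑ (λ b → 2 * inner (block b) + link b + link (prev b))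
      ≡⟨ ∑-distrib-+ (λ b → 2 * inner (block b) + link b) (link ∘ prev) ⟩
    ∑ (λ b → 2 * inner (block b) + link b) + ∑ (link ∘ prev)
      -- Each link leaves one block and enters another; `prev` permutes the blocks.
      ≡⟨ cong (∑ (λ b → 2 * inner (block b) + link b) +_) (sum-permute link (permutation prev next prev-next next-prev)) ⟨
    ∑ (λ b → 2 * inner (block b) + link b) + ∑ link
      ≡⟨ ∑-distrib-+ (λ b → 2 * inner (block b) + link b) link ⟨
    ∑ (λ b → 2 * inner (block b) + link b + link b)
      ≡⟨ sum-cong-≗ (λ b → solve 2 (λ i l → con 2 :* i :+ l :+ l := con 2 :* (i :+ l)) refl (inner (block b)) (link b)) ⟩
    ∑ (λ b → 2 * E b)
      ≡⟨ *-distribˡ-sum 2 E ⟨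
    2 * ∑ E ∎
    where
    open ≡-Reasoning
    open +-*-Solver

∑-enc : (g : Fin (8 * suc n) → ℕ) {h : Fin 8 → Fin (suc n) → ℕ} →
  (∀ x b → g (combine x b) ≡ h x b) → ∑ g ≡ ∑ {8} λ x → ∑ {suc n} λ b → h x b
∑-enc {n} g eq = trans (∑-combine 8 {suc n} g) (sum-cong-≗ {8} λ x → sum-cong-≗ {suc n} (eq x))

-- Compares the doubled quantities: crossing half-edges, indexed by vertex and colour, go to
-- distinct ordered pairs in `F` because `nbr i` is injective.
cut-≤-size : (F : EdgeSet (blockRing (suc n))) (X : Fin (8 * (2 + n)) → Bool) →
  (∀ i s → X i xor X (nbr {suc n} i s) ≡ true → EdgeSet.mem F i (nbr {suc n} i s) ≡ true) →
  ∑ (Cut.E (X ∘ enc)) ≤ size F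
cut-≤-size {n} F X cross = *-cancelˡ-≤ 2 (begin
  2 * ∑ (Cut.E Z)                                                    ≡⟨ ∑-half-edges Z ⟨
  ∑ {8} (λ x → ∑ {2 + n} λ b → ∑ {3} λ s → diff (Z (x , b)) (Z (nb (x , b) s)))
    ≡⟨ ∑-enc (λ i → ∑ {3} λ s → diff (X i) (X (nbr {suc n} i s))) (λ x b → sum-cong-≗ {3} λ s → cong (λ i → diff (Z (x , b)) (X i)) (nbr-enc (x , b) s)) ⟨
  ∑ (λ i → ∑ λ s → diff (X i) (X (nbr {suc n} i s)))                 ≤⟨ ∑-mono-≤ (λ i → ∑-mono-≤ λ s → 𝟙-mono (cross i s)) ⟩
  ∑ (λ i → ∑ λ s → 𝟙 (mem i (nbr {suc n} i s)))                      ≤⟨ ∑-mono-≤ (λ i → ∑-∘-injective-≤ (nbr-injective {suc n} i) (𝟙 ∘ mem i)) ⟩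
  ∑ (λ i → ∑ λ j → 𝟙 (mem i j))                                      ≤⟨ size-twice F ⟩
  2 * size F                                                         ∎)
  where
  open ≤-Reasoning
  open EdgeSet F
  Z : W (suc n) → Bool
  Z = X ∘ enc
  𝟙-mono : ∀ {a b} → (a ≡ true → b ≡ true) → 𝟙 a ≤ 𝟙 b
  𝟙-mono {true}  a⇒b = ≤-reflexive (sym (cong 𝟙 (a⇒b refl)))
  𝟙-mono {false} a⇒b = z≤n

-- From cycles in two components to edge cuts

cycle-next : {a : Fin n → Fin n → Bool} (C : Cycle a k) → let open Cycle C in
  ∀ i → Adj a (verts i) (verts (next i))
cycle-next C i with view i
... | ‵fromℕ          = Cycle.close C
... | ‵inj₁ {i = j} _ = Cycle.step C j

onCycle-neighbour : {a : Fin n → Fin n → Bool} {u : Fin n} → OnCycle a u → ∃ λ u′ → u ≢ u′ × Adj a u u′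
onCycle-neighbour (suc (suc k) , C , i , refl) =
  verts (next i) , (λ eq → next≢id i (sym (inj eq))) , cycle-next C i
  where open Cycle C
onCycle-neighbour (suc zero , record { long = s≤s () } , _)

-- Allows reachability to be assumed decidable at all vertices at once: the goal `k ≤ size F` is
-- decidable, hence stable under double negation.
¬¬-∀-Fin : {P : Fin n → Set} → (∀ i → ¬ ¬ P i) → ¬ ¬ (∀ i → P i)
¬¬-∀-Fin {zero}  _ ¬∀ = ¬∀ λ ()
¬¬-∀-Fin {suc n} h ¬∀ = h zero λ p₀ → ¬¬-∀-Fin (h ∘ suc) λ ps → ¬∀ λ { zero → p₀ ; (suc i) → ps i }

-- Only two vertices on each side of the cut are kept from the two cycles.
cuts⇒cyclicallyEdgeConnected : (G : Graph n) →
  (∀ (F : EdgeSet G) (X : Fin n → Bool) →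
    (∀ i j → adj G i j ≡ true → X i xor X j ≡ true → EdgeSet.mem F i j ≡ true) →
    ∀ {u u′ v v′} → u ≢ u′ → X u ≡ true → X u′ ≡ true → v ≢ v′ → X v ≡ false → X v′ ≡ false → k ≤ size F) →
  CyclicallyEdgeConnected k G
cuts⇒cyclicallyEdgeConnected {n} {k} G large F u v u-cyc v-cyc ¬uv
  with u′ , u≢u′ , uu′ ← onCycle-neighbour u-cyc
  with v′ , v≢v′ , vv′ ← onCycle-neighbour v-cyc =
  decidable-stable (k ≤? size F) λ k≰ →
    ¬¬-∀-Fin (λ w → ¬¬-excluded-middle {A = Star (Adj R) u w}) λ reach? → k≰ (component reach?)
  where
  open EdgeSet F
  R = remove G F
  R-sym : ∀ {i j} → Adj R i j → Adj R j i
  R-sym {i} {j} = subst (_≡ true) (cong₂ (λ a b → a ∧ not b) (Graph.sym G i j) (memSym i j))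
  component : (∀ w → Dec (Star (Adj R) u w)) → k ≤ size F
  component reach? = large F X cross
    u≢u′ (dec-true (reach? u) ε) (dec-true (reach? u′) (uu′ ◅ ε))
    v≢v′ (dec-false (reach? v) ¬uv) (dec-false (reach? v′) λ uv′ → ¬uv (uv′ ◅◅ R-sym vv′ ◅ ε))
    where
    X : Fin n → Bool
    X w = does (reach? w)
    cross : ∀ i j → adj G i j ≡ true → X i xor X j ≡ true → mem i j ≡ true
    cross i j ij xor with mem i j in eq
    ... | true  = refl
    ... | false with reach? i | reach? j
    ...   | yes ui | no ¬uj = contradiction (ui ◅◅ cong₂ (λ a b → a ∧ not b) ij eq ◅ ε) ¬uj
    ...   | no ¬ui | yes uj = contradiction (uj ◅◅ R-sym (cong₂ (λ a b → a ∧ not b) ij eq) ◅ ε) ¬ui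

blockRing-cyclicallyEdgeConnected : ∀ n → CyclicallyEdgeConnected 4 (blockRing (suc n))
blockRing-cyclicallyEdgeConnected n = cuts⇒cyclicallyEdgeConnected (blockRing (suc n))
  λ F X cross {u} {u′} {v} {v′} u≢u′ Xu Xu′ v≢v′ Xv Xv′ →
    let at : ∀ w {c} → X w ≡ c → X (enc (dec {suc n} w)) ≡ c
        at w = trans (cong X (enc-dec {suc n} w)) in
    ≤-trans
      (Cut.cut-≥4 (X ∘ enc) (u≢u′ ∘ dec-injective {suc n}) (at u Xu) (at u′ Xu′) (v≢v′ ∘ dec-injective {suc n}) (at v Xv) (at v′ Xv′))
      (cut-≤-size F X λ i s → cross i (nbr {suc n} i s) (adj-nbr {suc n} i s))

-- Long cycles

infixr 5 _∷_

data Chain {A : Set} (R : A → A → Set) : A → ℕ → A → Set where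
  []  : ∀ {x} → Chain R x 0 x
  _∷_ : ∀ {x y z k} → R x y → Chain R y k z → Chain R x (suc k) z

module _ {A : Set} {R : A → A → Set} where

  infixr 5 _++_
  _++_ : ∀ {x y z} → Chain R x k y → Chain R y l z → Chain R x (k + l) z
  []      ++ d = d
  (r ∷ c) ++ d = r ∷ (c ++ d)

  vertex : ∀ {x y} → Chain R x k y → Fin (suc k) → A
  vertex {x = x} c       zero    = x
  vertex         (r ∷ c) (suc i) = vertex c i

  vertex-step : ∀ {x y} (c : Chain R x k y) (i : Fin k) → R (vertex c (inject₁ i)) (vertex c (suc i))
  vertex-step (r ∷ c) zero    = r
  vertex-step (r ∷ c) (suc i) = vertex-step c i

  vertex-last : ∀ {x y} (c : Chain R x k y) → vertex c (fromℕ k) ≡ y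
  vertex-last []      = refl
  vertex-last (r ∷ c) = vertex-last c

  module _ {key : A → ℕ} (key-mono : ∀ {x y} → R x y → key x < key y) where

    vertex-mono : ∀ {x y} (c : Chain R x k y) {i j} → i Fin.< j → key (vertex c i) < key (vertex c j)
    vertex-mono (r ∷ c) {zero}  {suc zero}    _         = key-mono r
    vertex-mono (r ∷ c) {zero}  {suc (suc j)} _         = <-trans (key-mono r) (vertex-mono c (s≤s z≤n))
    vertex-mono (r ∷ c) {suc i} {suc j}       (s≤s i<j) = vertex-mono c i<j

    vertex-injective : ∀ {x y} (c : Chain R x k y) → Injective _≡_ _≡_ (vertex c)
    vertex-injective c {i} {j} eq with Finₚ.<-cmp i j
    ... | tri≈ _ i≡j _ = i≡j
    ... | tri< i<j _ _ = contradiction (cong key eq) (<⇒≢ (vertex-mono c i<j))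
    ... | tri> _ _ j<i = contradiction (cong key (sym eq)) (<⇒≢ (vertex-mono c j<i))

Edge : W n → W n → Set
Edge v w = ∃ λ s → nb v s ≡ w

edge-adj : {v w : W n} → Edge v w → adj (blockRing n) (enc v) (enc w) ≡ true
edge-adj {n} {v} (s , refl) = subst (λ i → adj (blockRing n) (enc v) i ≡ true) (nbr-enc v s) (adj-nbr {n} (enc v) s)

module LongCycle (n : ℕ) where

  -- The key of `(6F , 1F)`, where the inward passage ends and the turn in block 1 begins.
  M : ℕ
  M = 8 + 4 * suc n

  -- Increases along the cycle, so that its vertices are distinct; the one vertex
  -- (1F , suc (suc i)) of each middle block that is left out gets a junk value.
  key : W (suc n) → ℕ
  key (0F , zero)        = 0
  key (1F , zero)        = 1
  key (2F , zero)        = 2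
  key (3F , zero)        = 3
  key (7F , zero)        = 4
  key (6F , zero)        = 5
  key (5F , zero)        = 6
  key (4F , zero)        = 7
  key (6F , suc j)       = 8 + 4 * (suc n ∸ toℕ j)
  key (5F , suc (suc i)) = 8 + (4 * (n ∸ toℕ i) + 1)
  key (4F , suc (suc i)) = 8 + (4 * (n ∸ toℕ i) + 2)
  key (7F , suc zero)    = M + 1
  key (0F , suc zero)    = M + 2
  key (1F , suc zero)    = M + 3
  key (5F , suc zero)    = M + 4
  key (4F , suc zero)    = M + 5
  key (3F , suc zero)    = M + 6
  key (2F , suc j)       = M + (7 + 4 * toℕ j)
  key (0F , suc (suc i)) = M + (8 + 4 * toℕ i)
  key (7F , suc (suc i)) = M + (9 + 4 * toℕ i)
  key (3F , suc (suc i)) = M + (10 + 4 * toℕ i)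
  key (1F , suc (suc i)) = 0

  Step : W (suc n) → W (suc n) → Set
  Step v w = Edge v w × key v < key w

  -- The path 6 7 0 1 5 4 3 2 covers the block and returns to its right side.
  first-block : Chain Step (6F , 1F) 7 (2F , 1F)
  first-block =
    ((0F , refl) , m<m+n M (s≤s z≤n)) ∷ ((1F , refl) , up 1) ∷ ((0F , refl) , up 2) ∷ ((2F , refl) , up 3) ∷
    ((0F , refl) , up 4) ∷ ((1F , refl) , up 5) ∷ ((0F , refl) , up 6) ∷ []
    where
    up : ∀ l → M + l < M + suc l
    up l = +-monoʳ-< M (n<1+n l)

  -- The path 0 1 2 3 7 6 5 4 covers the block and returns to its left side.
  last-block : Chain Step (0F , 0F) 7 (4F , 0F)
  last-block =
    ((0F , refl) , n<1+n 0) ∷ ((1F , refl) , n<1+n 1) ∷ ((0F , refl) , n<1+n 2) ∷ ((2F , refl) , n<1+n 3) ∷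
    ((0F , refl) , n<1+n 4) ∷ ((1F , refl) , n<1+n 5) ∷ ((0F , refl) , n<1+n 6) ∷ []

  -- A middle block is crossed along 0 7 3 2 on the way out and along 6 5 4 on the way in; only
  -- vertex 1 is missed.
  outward : ∀ j → Chain Step (2F , 1F) (toℕ j * 4) (2F , suc j)
  outward = <-weakInduction _ [] λ i c →
    subst (λ t → Chain Step (2F , 1F) t (2F , suc (suc i))) (trans (+-comm (toℕ (inject₁ i) * 4) 4) (cong (λ t → suc t * 4) (Finₚ.toℕ-inject₁ i)))
      (c ++ ((2F , cong (0F ,_) (next-inject₁ (suc i))) , enter i) ∷
            ((1F , refl) , +-monoʳ-< M (n<1+n (8 + 4 * toℕ i))) ∷
            ((2F , refl) , +-monoʳ-< M (n<1+n (9 + 4 * toℕ i))) ∷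
            ((0F , refl) , +-monoʳ-< M (≤-reflexive (cong (7 +_) (sym (*-suc 4 (toℕ i)))))) ∷ [])
    where
    enter : (i : Fin n) → M + (7 + 4 * toℕ (inject₁ i)) < M + (8 + 4 * toℕ i)
    enter i = +-monoʳ-< M (≤-reflexive (cong (λ t → 8 + 4 * t) (Finₚ.toℕ-inject₁ i)))

  inward : ∀ j → Chain Step (6F , suc j) (toℕ j * 3) (6F , 1F)
  inward = <-weakInduction _ [] λ i c →
    ((1F , refl) , +-monoʳ-< 8 (m<m+n (4 * (n ∸ toℕ i)) (s≤s z≤n))) ∷
    ((0F , refl) , +-monoʳ-< 8 (+-monoʳ-< (4 * (n ∸ toℕ i)) (n<1+n 1))) ∷
    ((2F , refl) , leave i) ∷
    subst (λ t → Chain Step (6F , suc (inject₁ i)) (t * 3) (6F , 1F)) (Finₚ.toℕ-inject₁ i) c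
    where
    -- The key rises by two here: the inward passage has three vertices per block, but its keys are
    -- spaced by four.
    leave : (i : Fin n) → 8 + (4 * (n ∸ toℕ i) + 2) < 8 + 4 * (suc n ∸ toℕ (inject₁ i))
    leave i = +-monoʳ-< 8 (begin-strict
      4 * (n ∸ toℕ i) + 2            <⟨ +-monoʳ-< (4 * (n ∸ toℕ i)) (s≤s (s≤s (s≤s z≤n))) ⟩
      4 * (n ∸ toℕ i) + 4            ≡⟨ +-comm (4 * (n ∸ toℕ i)) 4 ⟩
      4 + 4 * (n ∸ toℕ i)            ≡⟨ *-suc 4 (n ∸ toℕ i) ⟨
      4 * suc (n ∸ toℕ i)            ≡⟨ cong (4 *_) (+-∸-assoc 1 (<⇒≤ (Finₚ.toℕ<n i))) ⟨
      4 * (suc n ∸ toℕ i)            ≡⟨ cong (λ t → 4 * (suc n ∸ t)) (Finₚ.toℕ-inject₁ i) ⟨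
      4 * (suc n ∸ toℕ (inject₁ i))  ∎)
      where open ≤-Reasoning

  around : Chain Step (0F , 0F) (7 + (1 + (toℕ (fromℕ n) * 3 + (7 + toℕ (fromℕ n) * 4)))) (2F , suc (fromℕ n))
  around = last-block ++ ((2F , refl) , s≤s (m≤m+n 7 _)) ∷ inward (fromℕ n) ++ first-block ++ outward (fromℕ n)

  longCycle : HasCycleOfLength (blockRing (suc n)) (7 * (2 + n) + 2)
  longCycle = subst (HasCycleOfLength (blockRing (suc n))) total record
    { long  = s≤s (s≤s z≤n)
    ; verts = enc ∘ vertex around
    ; inj   = vertex-injective proj₂ around ∘ enc-injective
    ; step  = λ i → edge-adj (proj₁ (vertex-step around i))
    ; close = edge-adj (subst (λ v → Edge v (0F , 0F)) (sym (vertex-last around)) (2F , cong (0F ,_) (next-fromℕ (suc n))))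
    }
    where
    total : 1 + (7 + (1 + (toℕ (fromℕ n) * 3 + (7 + toℕ (fromℕ n) * 4)))) ≡ 7 * (2 + n) + 2
    total = trans (cong (λ t → 1 + (7 + (1 + (t * 3 + (7 + t * 4))))) (Finₚ.toℕ-fromℕ n))
      (solve 1 (λ n → con 1 :+ (con 7 :+ (con 1 :+ (n :* con 3 :+ (con 7 :+ n :* con 4)))) := con 7 :* (con 2 :+ n) :+ con 2) refl n)
      where open +-*-Solver

-- Blocks covered by a cycle

-- Which of the edges at the vertices of one block lie on the cycle, by vertex and colour.
Uses : Set
Uses = Fin 8 → Fin 3 → Bool

-- `side` gives the colour that a used edge forces at `x`, depending on the colour at position
-- `tgt x s` of the same block; for a link it is a constant.
Respects : (Shift → Bool → Bool) → Uses → (Fin 8 → Bool) → Set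
Respects side u B = ∀ x s → u x s ≡ true → B x ≡ side (sh x s) (B (tgt x s))

respects? : ∀ side u B → Dec (Respects side u B)
respects? side u B = all? λ x → all? λ s → (u x s Boolₚ.≟ true) →-dec (B x Boolₚ.≟ side (sh x s) (B (tgt x s)))

-- For `separating`, `true` marks the part attached to the right and `false` the part attached to
-- the left. For `island`, no used link is attached to the part marked `true`.
separating island : Shift → Bool → Bool
separating stay c = c
separating fwd  _ = true
separating bwd  _ = false
island stay c = c
island fwd  _ = false
island bwd  _ = false

exactlyTwo : Bool → Bool → Bool → Bool
exactlyTwo true  b     c = b xor c
exactlyTwo false b     c = b ∧ c

-- If every vertex of the block has degree two in u, there are only 11 possibilities for u; in four of
-- them a path crosses the block, but then the rest of the block is a closed 5-cycle (an island).
separators islands : Fin 4 → Fin 8 → Bool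
separators 0F = row false false false false false false false false
separators 1F = row true  true  true  true  true  true  true  true
separators 2F = row false true  true  false false true  true  false
separators 3F = row false false true  true  false false true  true
islands 0F = row false true  true  true  true  true  false false
islands 1F = row true  true  false false false true  true  true
islands 2F = row false false false true  true  true  true  true
islands 3F = row true  true  true  true  false false false true

islands-proper : ∀ c → (∃ λ x → islands c x ≡ true) × (∃ λ x → islands c x ≡ false)
islands-proper = from-yes (all? λ c →
  (any? λ x → islands c x Boolₚ.≟ true) ×-dec (any? λ x → islands c x Boolₚ.≟ false))

-- Fourteen edges meet a block: the 8-cycle (`c`), the chords (`h`) and the links (`d`).
uses : (c₀ c₁ c₂ c₃ c₄ c₅ c₆ c₇ h₁ h₃ d₀ d₂ d₄ d₆ : Bool) → Uses
uses c₀ c₁ c₂ c₃ c₄ c₅ c₆ c₇ h₁ h₃ d₀ d₂ d₄ d₆ = table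
  where
  table : Uses
  table 0F 0F = c₀
  table 1F 0F = c₀
  table 2F 0F = c₂
  table 3F 0F = c₂
  table 4F 0F = c₄
  table 5F 0F = c₄
  table 6F 0F = c₆
  table 7F 0F = c₆
  table 0F 1F = c₇
  table 1F 1F = c₁
  table 2F 1F = c₁
  table 3F 1F = c₃
  table 4F 1F = c₃
  table 5F 1F = c₅
  table 6F 1F = c₅
  table 7F 1F = c₇
  table 0F 2F = d₀
  table 1F 2F = h₁
  table 2F 2F = d₂
  table 3F 2F = h₃
  table 4F 2F = d₄
  table 5F 2F = h₁
  table 6F 2F = d₆
  table 7F 2F = h₃

TwoRegular : Uses → Set
TwoRegular u = ∀ x → exactlyTwo (u x 0F) (u x 1F) (u x 2F) ≡ true

twoRegular? : ∀ u → Dec (TwoRegular u)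
twoRegular? u = all? λ x → exactlyTwo (u x 0F) (u x 1F) (u x 2F) Boolₚ.≟ true

Classified : Uses → Set
Classified u = (∃ λ c → Respects separating u (separators c)) ⊎ (∃ λ c → Respects island u (islands c))

classified? : ∀ u → Dec (Classified u)
classified? u = any? (λ c → respects? separating u (separators c)) ⊎-dec any? (λ c → respects? island u (islands c))

classify-uses : BoolFun 14
classify-uses c₀ c₁ c₂ c₃ c₄ c₅ c₆ c₇ h₁ h₃ d₀ d₂ d₄ d₆ =
  let u = uses c₀ c₁ c₂ c₃ c₄ c₅ c₆ c₇ h₁ h₃ d₀ d₂ d₄ d₆ in does (twoRegular? u →-dec classified? u)

-- A check of all subsets of the fourteen edges takes the place of an appeal to the
-- non-Hamiltonicity of the Petersen graph.
classify-all : Tautology 14 classify-uses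
classify-all = tautology 14 classify-uses refl

classify : (u : Uses) → (∀ x s → sh x s ≡ stay → u (tgt x s) s ≡ u x s) → TwoRegular u → Classified u
classify u u-sym two = transport (does-true (twoRegular? ū →-dec classified? ū) (classify-all
    (u 0F 0F) (u 1F 1F) (u 2F 0F) (u 3F 1F) (u 4F 0F) (u 5F 1F) (u 6F 0F) (u 0F 1F) (u 1F 2F) (u 3F 2F)
    (u 0F 2F) (u 2F 2F) (u 4F 2F) (u 6F 2F)) two-ū)
  where
  ū : Uses
  ū = uses (u 0F 0F) (u 1F 1F) (u 2F 0F) (u 3F 1F) (u 4F 0F) (u 5F 1F) (u 6F 0F) (u 0F 1F) (u 1F 2F) (u 3F 2F)
    (u 0F 2F) (u 2F 2F) (u 4F 2F) (u 6F 2F)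
  u≗ū : ∀ x s → u x s ≡ ū x s
  u≗ū 0F 0F = refl
  u≗ū 1F 0F = u-sym 0F 0F refl
  u≗ū 2F 0F = refl
  u≗ū 3F 0F = u-sym 2F 0F refl
  u≗ū 4F 0F = refl
  u≗ū 5F 0F = u-sym 4F 0F refl
  u≗ū 6F 0F = refl
  u≗ū 7F 0F = u-sym 6F 0F refl
  u≗ū 0F 1F = refl
  u≗ū 1F 1F = refl
  u≗ū 2F 1F = u-sym 1F 1F refl
  u≗ū 3F 1F = refl
  u≗ū 4F 1F = u-sym 3F 1F refl
  u≗ū 5F 1F = refl
  u≗ū 6F 1F = u-sym 5F 1F refl
  u≗ū 7F 1F = u-sym 0F 1F refl
  u≗ū 0F 2F = refl
  u≗ū 1F 2F = refl
  u≗ū 2F 2F = refl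
  u≗ū 3F 2F = refl
  u≗ū 4F 2F = refl
  u≗ū 5F 2F = u-sym 1F 2F refl
  u≗ū 6F 2F = refl
  u≗ū 7F 2F = u-sym 3F 2F refl
  two-ū : TwoRegular ū
  two-ū x rewrite sym (u≗ū x 0F) | sym (u≗ū x 1F) | sym (u≗ū x 2F) = two x
  transport : Classified ū → Classified u
  transport (inj₁ (c , resp)) = inj₁ (c , λ x s used → resp x s (trans (sym (u≗ū x s)) used))
  transport (inj₂ (c , resp)) = inj₂ (c , λ x s used → resp x s (trans (sym (u≗ū x s)) used))

two-of-three : (u : Fin 3 → Bool) (s t : Fin 3) → s ≢ t → u s ≡ true → u t ≡ true →
  (∀ r → u r ≡ true → r ≡ s ⊎ r ≡ t) → exactlyTwo (u 0F) (u 1F) (u 2F) ≡ true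
two-of-three u s t s≢t us ut only = go s t s≢t us ut off
  where
  off : ∀ r → r ≢ s → r ≢ t → u r ≡ false
  off r r≢s r≢t = Boolₚ.¬-not λ ur → [ r≢s , r≢t ]′ (only r ur)
  go : ∀ s t → s ≢ t → u s ≡ true → u t ≡ true → (∀ r → r ≢ s → r ≢ t → u r ≡ false) →
    exactlyTwo (u 0F) (u 1F) (u 2F) ≡ true
  go 0F 1F _ us ut off rewrite us | ut | off 2F (λ ()) (λ ()) = refl
  go 0F 2F _ us ut off rewrite us | ut | off 1F (λ ()) (λ ()) = refl
  go 1F 0F _ us ut off rewrite us | ut | off 2F (λ ()) (λ ()) = refl
  go 1F 2F _ us ut off rewrite us | ut | off 0F (λ ()) (λ ()) = refl
  go 2F 0F _ us ut off rewrite us | ut | off 1F (λ ()) (λ ()) = refl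
  go 2F 1F _ us ut off rewrite us | ut | off 0F (λ ()) (λ ()) = refl
  go 0F 0F ne = contradiction refl ne
  go 1F 1F ne = contradiction refl ne
  go 2F 2F ne = contradiction refl ne

∑-𝟙-< : (f : Fin (suc n) → Bool) {i : Fin (suc n)} → f i ≡ false → ∑ (𝟙 ∘ f) ≤ n
∑-𝟙-< {n} f {i} fi = begin
  ∑ (𝟙 ∘ f)                                    ≡⟨ sum-remove {i = i} (𝟙 ∘ f) ⟩
  𝟙 (f i) + ∑ (λ j → 𝟙 (f (Fin.punchIn i j)))  ≡⟨ cong (λ b → 𝟙 b + ∑ (λ j → 𝟙 (f (Fin.punchIn i j)))) fi ⟩
  ∑ (λ j → 𝟙 (f (Fin.punchIn i j)))            ≤⟨ ∑-mono-≤ (λ j → 𝟙-≤1 (f (Fin.punchIn i j))) ⟩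
  ∑ {n} (λ _ → 1)                              ≡⟨ ∑-const n 1 ⟩
  n * 1                                        ≡⟨ *-identityʳ n ⟩
  n                                            ∎
  where
  open ≤-Reasoning
  𝟙-≤1 : ∀ b → 𝟙 b ≤ 1
  𝟙-≤1 true  = ≤-refl
  𝟙-≤1 false = z≤n

-- Labellings constant along a cycle

module ClosedWalk {n k} (g : Fin (3 + k) → W (suc n)) (g-injective : Injective _≡_ _≡_ g)
  (g-next : ∀ i → ∃ λ s → nb (g i) s ≡ g (next i)) where

  V : Set
  V = W (suc n)

  _≟V_ : (v w : V) → Dec (v ≡ w)
  _≟V_ = ≡-dec _≟_ _≟_

  g-prev : ∀ i → ∃ λ s → nb (g i) s ≡ g (prev i)
  g-prev i with s , eq ← g-next (prev i) = s , (begin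
    nb (g i) s                ≡⟨ cong (λ j → nb (g j) s) (next-prev i) ⟨
    nb (g (next (prev i))) s  ≡⟨ cong (λ v → nb v s) eq ⟨
    nb (nb (g (prev i)) s) s  ≡⟨ nb-involutive (g (prev i)) s ⟩
    g (prev i)                ∎)
    where open ≡-Reasoning

  arc? : ∀ v w → Dec (∃ λ i → g i ≡ v × g (next i) ≡ w)
  arc? v w = any? λ i → (g i ≟V v) ×-dec (g (next i) ≟V w)

  used : V → V → Bool
  used v w = does (arc? v w) ∨ does (arc? w v)

  used-sym : ∀ v w → used v w ≡ used w v
  used-sym v w = Boolₚ.∨-comm (does (arc? v w)) (does (arc? w v))

  used-next : ∀ i → used (g i) (g (next i)) ≡ true
  used-next i = cong (_∨ does (arc? (g (next i)) (g i))) (dec-true (arc? (g i) (g (next i))) (i , refl , refl))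

  used-prev : ∀ i → used (g i) (g (prev i)) ≡ true
  used-prev i = trans (used-sym (g i) (g (prev i)))
    (subst (λ j → used (g (prev i)) (g j) ≡ true) (next-prev i) (used-next (prev i)))

  used-only : ∀ i w → used (g i) w ≡ true → w ≡ g (next i) ⊎ w ≡ g (prev i)
  used-only i w eq with ∨-true eq
  ... | inj₁ out with j , gj , gj⁺ ← does-true (arc? (g i) w) out =
    inj₁ (trans (sym gj⁺) (cong (g ∘ next) (g-injective gj)))
  ... | inj₂ in′ with j , gj , gj⁺ ← does-true (arc? w (g i)) in′ =
    inj₂ (trans (sym gj) (cong g (trans (sym (prev-next j)) (cong prev (g-injective gj⁺)))))

  usesAt : Fin (2 + n) → Uses
  usesAt b x s = used (x , b) (nb (x , b) s)

  nb-injective : ∀ (v : V) {s t} → nb v s ≡ nb v t → s ≡ t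
  nb-injective (x , b) eq = tgt-injective x _ _ (cong proj₁ eq)

  two-used : ∀ i → let v = g i in exactlyTwo (used v (nb v 0F)) (used v (nb v 1F)) (used v (nb v 2F)) ≡ true
  two-used i with s , es ← g-next i with t , et ← g-prev i =
    two-of-three (λ r → used (g i) (nb (g i) r)) s t
      -- The cycle has length at least three, so its two edges at `g i` lead to different vertices.
      (λ { refl → next≢prev i (g-injective (trans (sym es) et)) })
      (trans (cong (used (g i)) es) (used-next i))
      (trans (cong (used (g i)) et) (used-prev i))
      λ r ur → Sum.map (λ e → nb-injective (g i) (trans e (sym es))) (λ e → nb-injective (g i) (trans e (sym et)))
        (used-only i (nb (g i) r) ur)

  -- Each link is tested from its left end; `used-edge-invariant` recovers the view from the right
  -- end.
  Invariant : (V → Bool) → Set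
  Invariant h = (∀ x s c → sh x s ≡ stay → used (x , c) (tgt x s , c) ≡ true → h (x , c) ≡ h (tgt x s , c)) ×
                (∀ x s c → sh x s ≡ fwd → used (x , c) (tgt x s , next c) ≡ true → h (x , c) ≡ h (tgt x s , next c))

  used-edge-invariant : ∀ {h} → Invariant h → ∀ x s c → used (x , c) (nb (x , c) s) ≡ true → h (nb (x , c) s) ≡ h (x , c)
  used-edge-invariant {h} (inside , across) x s c u with sh x s in eq
  ... | stay = sym (inside x s c eq u)
  ... | fwd  = sym (across x s c eq u)
  ... | bwd  = trans (across (tgt x s) s (prev c) (trans (sh-tgt x s) (cong opp eq))
                       (trans (cong (used (tgt x s , prev c)) back) (trans (used-sym (tgt x s , prev c) (x , c)) u)))
                     (cong h back)
    where
    back : (tgt (tgt x s) s , next (prev c)) ≡ (x , c)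
    back = cong₂ _,_ (tgt-involutive x s) (next-prev c)

  invariant-constant : ∀ {h} → Invariant h → ∀ i j → h (g i) ≡ h (g j)
  invariant-constant {h} inv = next-invariant (h ∘ g) λ i →
    let s , eq = g-next i in
    trans (cong h (sym eq)) (used-edge-invariant inv (proj₁ (g i)) s (proj₂ (g i))
      (trans (cong (used (g i)) eq) (used-next i)))

  On : V → Set
  On v = ∃ λ i → g i ≡ v

  Full : Fin (2 + n) → Set
  Full b = ∀ x → On (x , b)

  on-constant : ∀ {h v w} → Invariant h → On v → On w → h v ≡ h w
  on-constant inv (i , refl) (j , refl) = invariant-constant inv i j

  usesAt-sym : ∀ b x s → sh x s ≡ stay → usesAt b (tgt x s) s ≡ usesAt b x s
  usesAt-sym b x s eq = begin
    used (tgt x s , b) (nb (tgt x s , b) s)     ≡⟨ cong (λ v → used v (nb v s)) to ⟨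
    used (nb (x , b) s) (nb (nb (x , b) s) s)   ≡⟨ cong (used (nb (x , b) s)) (nb-involutive (x , b) s) ⟩
    used (nb (x , b) s) (x , b)                 ≡⟨ used-sym (nb (x , b) s) (x , b) ⟩
    used (x , b) (nb (x , b) s)                 ∎
    where
    open ≡-Reasoning
    to : nb (x , b) s ≡ (tgt x s , b)
    to = cong (λ d → tgt x s , shift d b) eq

  full-classified : ∀ b → Full b → Classified (usesAt b)
  full-classified b full = classify (usesAt b) (usesAt-sym b) λ x →
    let i , eq = full x in
    subst (λ v → exactlyTwo (used v (nb v 0F)) (used v (nb v 1F)) (used v (nb v 2F)) ≡ true) eq (two-used i)

  module At {side p B} (resp : Respects side (usesAt p) B) where

    within : ∀ x s → sh x s ≡ stay → used (x , p) (tgt x s , p) ≡ true → B x ≡ side stay (B (tgt x s))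
    within x s eq u with r ← resp x s rewrite eq = r u

    leaving-fwd : ∀ x s → sh x s ≡ fwd → used (x , p) (tgt x s , next p) ≡ true → B x ≡ side fwd (B (tgt x s))
    leaving-fwd x s eq u with r ← resp x s rewrite eq = r u

    -- The condition is read at the right end of the link, where its shift is `bwd`.
    entering-fwd : ∀ x s c → sh x s ≡ fwd → next c ≡ p → used (x , c) (tgt x s , next c) ≡ true →
      B (tgt x s) ≡ side bwd (B x)
    entering-fwd x s c eq refl u = trans (resp (tgt x s) s (trans (cong (used (tgt x s , next c)) back) (trans (used-sym _ (x , c)) u)))
      (cong₂ (λ d y → side d (B y)) flipped (tgt-involutive x s))
      where
      flipped : sh (tgt x s) s ≡ bwd
      flipped = trans (sh-tgt x s) (cong opp eq)
      back : nb (tgt x s , next c) s ≡ (x , c)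
      back = cong₂ _,_ (tgt-involutive x s) (trans (cong (λ d → shift d (next c)) flipped) (prev-next c))

  -- Extended by `false` to the other blocks, `B` is invariant, hence constant on the cycle, which
  -- passes through all of block `p`.
  no-island : ∀ p → Full p → ∀ B → Respects island (usesAt p) B → ∀ {x y} → B x ≡ true → B y ≡ false → ⊥
  no-island p full B resp {x} {y} Bx By = contradiction (trans (sym (trans (here x) Bx)) (trans (on-constant {h} (inside , across) (full x) (full y)) (trans (here y) By))) λ ()
    where
    open At {island} {p} {B} resp
    h : V → Bool
    h (x , c) = does (c ≟ p) ∧ B x
    here : ∀ x → h (x , p) ≡ B x
    here x = cong (_∧ B x) (dec-true (p ≟ p) refl)
    inside : ∀ x s c → sh x s ≡ stay → used (x , c) (tgt x s , c) ≡ true → h (x , c) ≡ h (tgt x s , c)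
    inside x s c eq u with c ≟ p
    ... | yes refl = within x s eq u
    ... | no _     = refl
    across : ∀ x s c → sh x s ≡ fwd → used (x , c) (tgt x s , next c) ≡ true → h (x , c) ≡ h (tgt x s , next c)
    across x s c eq u = trans from-false (sym to-false)
      where
      from-false : h (x , c) ≡ false
      from-false with c ≟ p
      ... | yes refl = leaving-fwd x s eq u
      ... | no _     = refl
      to-false : h (tgt x s , next c) ≡ false
      to-false with next c ≟ p
      ... | yes nc = entering-fwd x s c eq nc u
      ... | no _   = refl

  -- Cutting the ring at covered blocks

  Separator : Fin (2 + n) → Set
  Separator p = ∃ λ B → Respects separating (usesAt p) B

  full-separator : ∀ p → Full p → Separator p
  full-separator p full =
    [ (λ (c , resp) → separators c , resp)
    , (λ (c , resp) → let (_ , inside) , (_ , outside) = islands-proper c in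
        ⊥-elim (no-island p full (islands c) resp inside outside))
    ]′ (full-classified p full)

  -- The ring is opened between the last block and block zero; only used links there can join
  -- different values.
  after : ∀ {p} → Separator p → V → Bool
  after {p} (B , _) (x , c) with Finₚ.<-cmp c p
  ... | tri< _ _ _ = false
  ... | tri≈ _ _ _ = B x
  ... | tri> _ _ _ = true

  module _ {p} (S : Separator p) where
    open At {separating} {p} {proj₁ S} (proj₂ S)

    after-< : ∀ x {c} → c Fin.< p → after S (x , c) ≡ false
    after-< x {c} c<p with Finₚ.<-cmp c p
    ... | tri< _ _ _   = refl
    ... | tri≈ c≮p _ _ = contradiction c<p c≮p
    ... | tri> c≮p _ _ = contradiction c<p c≮p

    after-≡ : ∀ x → after S (x , p) ≡ proj₁ S x
    after-≡ x with Finₚ.<-cmp p p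
    ... | tri< _ p≢p _ = contradiction refl p≢p
    ... | tri≈ _ _ _   = refl
    ... | tri> _ p≢p _ = contradiction refl p≢p

    after-> : ∀ x {c} → p Fin.< c → after S (x , c) ≡ true
    after-> x {c} p<c with Finₚ.<-cmp c p
    ... | tri< _ _ p≮c = contradiction p<c p≮c
    ... | tri≈ _ _ p≮c = contradiction p<c p≮c
    ... | tri> _ _ _   = refl

    after-stay : ∀ x s c → sh x s ≡ stay → used (x , c) (tgt x s , c) ≡ true → after S (x , c) ≡ after S (tgt x s , c)
    after-stay x s c eq u with Finₚ.<-cmp c p
    ... | tri< _ _ _    = refl
    ... | tri≈ _ refl _ = within x s eq u
    ... | tri> _ _ _    = refl

    after-leaving : ∀ x s c → sh x s ≡ fwd → used (x , c) (tgt x s , next c) ≡ true → p Fin.≤ c → after S (x , c) ≡ true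
    after-leaving x s c eq u p≤c with Finₚ.<-cmp c p
    ... | tri< c<p _ _  = contradiction p≤c (<⇒≱ c<p)
    ... | tri≈ _ refl _ = leaving-fwd x s eq u
    ... | tri> _ _ _    = refl

    after-entering : ∀ x s c → sh x s ≡ fwd → used (x , c) (tgt x s , next c) ≡ true → next c Fin.≤ p →
      after S (tgt x s , next c) ≡ false
    after-entering x s c eq u c⁺≤p with Finₚ.<-cmp (next c) p
    ... | tri< _ _ _   = refl
    ... | tri≈ _ c⁺≡p _ = entering-fwd x s c eq c⁺≡p u
    ... | tri> _ _ p<c⁺ = contradiction c⁺≤p (<⇒≱ p<c⁺)

    -- No link jumps over block `p`: one that starts at `p` or later has both ends `true`, and any
    -- other ends at `p` or earlier and has both ends `false`.
    after-step : ∀ x s j → sh x s ≡ fwd → let c = inject₁ j in used (x , c) (tgt x s , next c) ≡ true →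
      after S (x , c) ≡ after S (tgt x s , next c)
    after-step x s j eq u with p Finₚ.≤? inject₁ j
    ... | yes p≤j = trans (after-leaving x s (inject₁ j) eq u p≤j)
                      (sym (after-> (tgt x s) (subst (p Fin.<_) (sym (next-inject₁ j)) (s≤s (subst (toℕ p ≤_) (Finₚ.toℕ-inject₁ j) p≤j)))))
    ... | no p≰j  = trans (after-< x (≰⇒> p≰j))
                      (sym (after-entering x s (inject₁ j) eq u (subst (Fin._≤ p) (sym (next-inject₁ j)) (subst (λ t → suc t ≤ toℕ p) (Finₚ.toℕ-inject₁ j) (≰⇒> p≰j)))))

  -- For `p` before `q`, this marks the right part of block `p`, the blocks strictly between, and
  -- the left part of block `q`.
  between : ∀ {p q} → Separator p → Separator q → V → Bool
  between S S′ v = after S v ∧ not (after S′ v)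

  -- On the links from the last block to block zero, where after S and after S′ may both change,
  -- the conjunction is false at both ends.
  between-invariant : ∀ {p q} (S : Separator p) (S′ : Separator q) → Invariant (between S S′)
  between-invariant {p} {q} S S′ =
    (λ x s c eq u → cong₂ (λ a b → a ∧ not b) (after-stay S x s c eq u) (after-stay S′ x s c eq u)) ,
    (λ x s c eq u → across x s (view c) eq u)
    where
    across : ∀ x s {c} → View c → sh x s ≡ fwd → used (x , c) (tgt x s , next c) ≡ true →
      between S S′ (x , c) ≡ between S S′ (tgt x s , next c)
    across x s (‵inj₁ {i = j} _) eq u =
      cong₂ (λ a b → a ∧ not b) (after-step S x s j eq u) (after-step S′ x s j eq u)
    across x s ‵fromℕ eq u = trans
      (trans (cong (λ b → after S (x , fromℕ (suc n)) ∧ not b) (after-leaving S′ x s (fromℕ (suc n)) eq u (Finₚ.≤fromℕ q)))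
        (Boolₚ.∧-zeroʳ (after S (x , fromℕ (suc n)))))
      (sym (cong (_∧ not (after S′ (tgt x s , next (fromℕ (suc n)))))
        (after-entering S x s (fromℕ (suc n)) eq u (subst (Fin._≤ p) (sym (next-fromℕ (suc n))) z≤n))))

  -- If vertex 0 of block `q` is in its left part, the piece between `p` and `q` contains it but
  -- misses block `r`; otherwise the piece between `q` and `r` contains it but misses block `p`.
  no-three-full : ∀ {p q r} → p Fin.< q → q Fin.< r → Full p → Full q → Full r → ⊥
  no-three-full {p} {q} {r} p<q q<r full-p full-q full-r =
    decide (proj₁ Sq 0F) refl
    where
    Sp = full-separator p full-p
    Sq = full-separator q full-q
    Sr = full-separator r full-r
    decide : ∀ b → proj₁ Sq 0F ≡ b → ⊥
    decide false eq = contradiction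
      (trans (sym (cong₂ (λ a b → a ∧ not b) (after-> Sp 0F p<q) (trans (after-≡ Sq 0F) eq)))
        (trans (on-constant {between Sp Sq} (between-invariant Sp Sq) (full-q 0F) (full-r 0F))
          (cong₂ (λ a b → a ∧ not b) (after-> Sp 0F (<-trans p<q q<r)) (after-> Sq 0F q<r)))) λ ()
    decide true eq = contradiction
      (trans (sym (cong₂ (λ a b → a ∧ not b) (trans (after-≡ Sq 0F) eq) (after-< Sr 0F q<r)))
        (trans (on-constant {between Sq Sr} (between-invariant Sq Sr) (full-q 0F) (full-p 0F))
          (cong (_∧ not (after Sr (0F , p))) (after-< Sq 0F p<q)))) λ ()

-- Counting the vertices of a cycle by blocks

covered-≤ : (f : Fin 8 → Bool) → ∑ (𝟙 ∘ f) ≤ 7 + 𝟙 (does (all? λ x → f x Boolₚ.≟ true))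
covered-≤ f = bound (all? λ x → f x Boolₚ.≟ true)
  where
  bound : (full? : Dec (∀ x → f x ≡ true)) → ∑ (𝟙 ∘ f) ≤ 7 + 𝟙 (does full?)
  bound (yes full) = ≤-reflexive (sum-cong-≗ {8} (λ x → cong 𝟙 (full x)))
  bound (no ¬full) = let x , fx = Finₚ.¬∀⟶∃¬ 8 (λ x → f x ≡ true) (λ x → f x Boolₚ.≟ true) ¬full in
    ∑-𝟙-< f {x} (Boolₚ.¬-not fx)

at-most-two-full : (on : Fin 8 → Fin n → Bool) →
  (∀ {p q r} → p Fin.< q → q Fin.< r → (∀ x → on x p ≡ true) → (∀ x → on x q ≡ true) → (∀ x → on x r ≡ true) → ⊥) →
  ∑ (λ x → ∑ λ b → 𝟙 (on x b)) ≤ 7 * n + 2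
at-most-two-full {n} on no-three = begin
  ∑ {8} (λ x → ∑ λ b → 𝟙 (on x b))         ≡⟨ ∑-comm (λ x b → 𝟙 (on x b)) ⟩
  ∑ (λ b → ∑ {8} λ x → 𝟙 (on x b))         ≤⟨ ∑-mono-≤ (λ b → covered-≤ λ x → on x b) ⟩
  ∑ (λ b → 7 + 𝟙 (does (full? b)))         ≡⟨ ∑-distrib-+ {n} (λ _ → 7) (λ b → 𝟙 (does (full? b))) ⟩
  ∑ {n} (λ _ → 7) + ∑ (𝟙 ∘ does ∘ full?)   ≡⟨ cong (_+ ∑ (𝟙 ∘ does ∘ full?)) (trans (∑-const n 7) (*-comm n 7)) ⟩
  7 * n + ∑ (𝟙 ∘ does ∘ full?)             ≤⟨ +-monoʳ-≤ (7 * n) (≮⇒≥ few) ⟩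
  7 * n + 2                                ∎
  where
  open ≤-Reasoning
  full? : ∀ b → Dec (∀ x → on x b ≡ true)
  full? b = all? λ x → on x b Boolₚ.≟ true
  few : ¬ 2 < ∑ (𝟙 ∘ does ∘ full?)
  few 3≤ with p , q , r , p<q , q<r , fp , fq , fr ← three-true (does ∘ full?) 3≤ =
    no-three p<q q<r (does-true (full? p) fp) (does-true (full? q) fq) (does-true (full? r) fr)

cycle-length-≤ : Cycle (adj (blockRing (suc n))) (2 + k) → 3 + k ≤ 7 * (2 + n) + 2
cycle-length-≤ {n} {k} C = ≤-trans
  (≤-reflexive (sym (trans (sym (∑-enc {suc n} (𝟙 ∘ image verts) {λ x b → 𝟙 (image verts (combine x b))} (λ _ _ → refl))) (∑-image inj))))
  (at-most-two-full {2 + n} (λ x b → image verts (combine x b)) λ {p} {q} {r} p<q q<r fp fq fr →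
    no-three-full p<q q<r (on-cycle p fp) (on-cycle q fq) (on-cycle r fr))
  where
  open Cycle C
  g : Fin (3 + k) → W (suc n)
  g = dec {suc n} ∘ verts
  g-next : ∀ i → ∃ λ s → nb (g i) s ≡ g (next i)
  g-next i = let s , eq = nbr-adj {suc n} (verts i) (verts (next i)) (cycle-next C i) in
    s , trans (sym (dec-nbr {suc n} (verts i) s)) (cong (dec {suc n}) eq)
  open ClosedWalk g (inj ∘ dec-injective {suc n}) g-next
  on-cycle : ∀ b → (∀ x → image verts (combine x b) ≡ true) → Full b
  on-cycle b full x = let i , eq = does-true (any? λ i → verts i ≟ combine x b) (full x) in
    i , trans (cong (dec {suc n}) eq) (dec-enc (x , b))

theorem1 : ∀ (m : ℕ) → 2 ≤ m →
    Σ (Graph (8 * m)) (λ G →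
    Cubic G × CyclicallyEdgeConnected 4 G × Circumference G (7 * m + 2))
theorem1 (suc (suc n)) _ =
  blockRing (suc n) , blockRing-cubic (suc n) , blockRing-cyclicallyEdgeConnected n , LongCycle.longCycle n , longest
  where
  longest : ∀ ℓ → HasCycleOfLength (blockRing (suc n)) ℓ → ℓ ≤ 7 * (2 + n) + 2
  longest (suc (suc (suc k))) C                        = cycle-length-≤ C
  longest (suc (suc zero))    record { long = s≤s () }
  longest (suc zero)          record { long = () }
theorem1 (suc zero) (s≤s ())
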